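{- Let $M$ be a matroid of finite rank on a set $E$, where $E$ is finite or countably infinite. Then $M$ is embeddable in an OTE matroid of the same rank, i.e. there is an OTE matroid $N$ of rank equal to that of $M$ on a ground set containing $E$ with $N|E=M$.
   Context: A modular cut of a matroid $M$ is a set $\mathcal{M}$ of flats such that (1) any flat containing a member of $\mathcal{M}$ is in $\mathcal{M}$; (2) if $F_1,F_2\in\mathcal{M}$ form a modular pair, i.e. $\operatorname{rk}(F_1)+\operatorname{rk}(F_2)=\operatorname{rk}(F_1\cup F_2)+\operatorname{rk}(F_1\cap F_2)$, then $F_1\cap F_2\in\mathcal{M}$. A modular cut is principal if it equals $\{G: G\text{ a flat}, G\supseteq F\}$ for some flat $F$. A matroid is OTE if every modular cut other than the empty one is principal. -}

module Defs where

open import Level using (0ℓ)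
open import Data.Nat using (ℕ; _≤_; _<_; _+_)
open import Data.List using (List; []; _∷_; length)
open import Data.List.Relation.Unary.All using (All)
open import Data.List.Relation.Unary.Unique.Propositional using (Unique)
open import Data.List.Membership.Propositional using (_∈_; _∉_)
open import Data.Product using (Σ; ∃; ∃-syntax; _×_; _,_)
open import Relation.Binary.PropositionalEquality using (_≡_)
open import Relation.Unary using (Pred; _⊆_; _∪_; _∩_; ｛_｝)
open import Function using (_⇔_)
open import Function.Definitions using (Injective)

-- A matroid of finite rank on a (possibly infinite) ground set E.
-- Since the rank is finite, every independent set is finite, so the
-- matroid is determined by its finite independent sets, represented as
-- duplicate-free lists.
record Matroid (E : Set) : Set₁ where
  field
    Indep      : List E → Set
    indep⇒uniq : ∀ {xs} → Indep xs → Unique xs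
    indep-[]   : Indep []
    indep-sub  : ∀ {xs ys} → Indep ys → Unique xs
               → (∀ {x} → x ∈ xs → x ∈ ys) → Indep xs
    indep-aug  : ∀ {xs ys} → Indep xs → Indep ys → length xs < length ys
               → ∃[ y ] (y ∈ ys × y ∉ xs × Indep (y ∷ xs))
    rank       : ℕ
    rank-basis : ∃[ bs ] (Indep bs × length bs ≡ rank)
    rank-bound : ∀ {xs} → Indep xs → length xs ≤ rank

module _ {E : Set} (M : Matroid E) where
  open Matroid M

  HasRank : Pred E 0ℓ → ℕ → Set
  HasRank X k =
    (∃[ xs ] (Indep xs × All X xs × length xs ≡ k)) ×
    (∀ ys → Indep ys → All X ys → length ys ≤ k)

  Flat : Pred E 0ℓ → Set
  Flat F = ∀ x k → HasRank F k → HasRank (F ∪ ｛ x ｝) k → F x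

  ModularPair : Pred E 0ℓ → Pred E 0ℓ → Set
  ModularPair F₁ F₂ = ∃[ a ] ∃[ b ] ∃[ c ] ∃[ d ]
    (HasRank F₁ a × HasRank F₂ b × HasRank (F₁ ∪ F₂) c × HasRank (F₁ ∩ F₂) d
     × a + b ≡ c + d)

  record IsModularCut (𝓜 : Pred (Pred E 0ℓ) 0ℓ) : Set₁ where
    field
      flats  : ∀ F → 𝓜 F → Flat F
      upward : ∀ F G → 𝓜 F → Flat G → F ⊆ G → 𝓜 G
      modint : ∀ F₁ F₂ → 𝓜 F₁ → 𝓜 F₂ → ModularPair F₁ F₂ → 𝓜 (F₁ ∩ F₂)

  Principal : Pred (Pred E 0ℓ) 0ℓ → Set₁
  Principal 𝓜 = ∃[ F ] (Flat F × (∀ G → Flat G → (𝓜 G ⇔ F ⊆ G)))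

  OTE : Set₁
  OTE = ∀ (𝓜 : Pred (Pred E 0ℓ) 0ℓ) → IsModularCut 𝓜 → (∃[ F ] 𝓜 F) → Principal 𝓜

Countable : Set → Set
Countable E = ∃[ f ] (Injective {A = E} {B = ℕ} _≡_ _≡_ f)

{-# OPTIONS --safe #-}

-- The elements of the extension N are those of E together with points
-- p₀, p₁, …, all of which start out as loops.  At stage n the loop pₙ is
-- replaced by the single-element extension belonging to the modular cut
-- generated by two finitely spanned flats cl S and cl T, where every pair
-- (S , T) of finite lists is treated at infinitely many stages.  If a modular
-- cut 𝓜 of the limit contains cl B and cl D, let I span cl B ∩ cl D and look
-- at a stage n treating (B , D) after all elements of B, D and I have appeared.
-- As pₙ lies in cl B ∩ cl D = cl I, the cut generated at stage n contains
-- cl I; since modular pairs of a stage remain modular in the limit, it follows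
-- that cl I ∈ 𝓜.  So 𝓜 is closed under intersection, hence principal by
-- finiteness of the rank.

module Submission where

open import Defs
open import Level using (0ℓ)
open import Axiom.ExcludedMiddle using (ExcludedMiddle)
open import Data.Bool using (if_then_else_)
open import Data.Empty using (⊥)
open import Data.List using (List; []; _∷_; _++_; length; map; filter)
open import Data.List.Membership.Propositional using (_∈_; _∉_; find)
open import Data.List.Membership.Propositional.Properties
  using (∈-filter⁺; ∈-filter⁻; ∈-map⁺; ∈-map⁻)
open import Data.List.Properties using (length-map)
open import Data.List.Relation.Binary.Subset.Propositional using (_⊆_)
open import Data.List.Relation.Binary.Subset.Propositional.Properties
  using (⊆-refl; ∷⁺ʳ; ∈-∷⁺ʳ; xs⊆x∷xs; xs⊆xs++ys; xs⊆ys++xs)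
open import Data.List.Relation.Unary.All as All using (All; []; _∷_; all?)
open import Data.List.Relation.Unary.All.Properties using (¬All⇒Any¬)
open import Data.List.Relation.Unary.AllPairs using ([]; _∷_)
open import Data.List.Relation.Unary.Any using (here; there)
open import Data.List.Relation.Unary.Unique.Propositional using (Unique)
open import Data.Nat
open import Data.Nat.Properties
open import Data.Product using (Σ; ∃; ∃-syntax; _×_; _,_; proj₁; proj₂)
open import Data.Sum using (_⊎_; inj₁; inj₂)
open import Data.Sum.Properties using (inj₁-injective)
open import Function using (_⇔_; _∘_; id; mk⇔)
open import Function.Definitions using (Injective)
open import Relation.Binary.PropositionalEquality
open import Relation.Nullary using (Dec; yes; no; ¬_; ¬?; contradiction)
open import Relation.Nullary.Decidable using (⌊_⌋; decidable-stable)
open import Relation.Unary using (Pred; _∪_; _∩_; ｛_｝) renaming (_⊆_ to _⊑_)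

-- Rank functions

-- By `rk-mono` the rank depends only on the set of entries of a list. Adding an element raises it
-- by 0 or 1, so `rk-cl` is submodularity in local form. The bound `R` is shared by all stages of
-- the construction.
record RankFunction (U : Set) (R : ℕ) : Set where
  field
    rk      : List U → ℕ
    rk-[]   : rk [] ≡ 0
    rk-mono : ∀ {A B} → A ⊆ B → rk A ≤ rk B
    rk-∷    : ∀ x A → rk (x ∷ A) ≤ suc (rk A)
    rk-cl   : ∀ {A B} x → A ⊆ B → rk (x ∷ A) ≤ rk A → rk (x ∷ B) ≤ rk B
    rk-≤    : ∀ A → rk A ≤ R

  cl : List U → Pred U 0ℓ
  cl A x = rk (x ∷ A) ≤ rk A

  cl? : ∀ A x → Dec (cl A x)
  cl? A x = rk (x ∷ A) ≤? rk A

  infix 4 _⊆cl_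
  _⊆cl_ : List U → List U → Set
  A ⊆cl B = ∀ {a} → a ∈ A → cl B a

  cl-∈ : ∀ {A} → A ⊆cl A
  cl-∈ x∈A = rk-mono (∈-∷⁺ʳ x∈A ⊆-refl)

  cl-mono : ∀ {A B} → A ⊆ B → cl A ⊑ cl B
  cl-mono A⊆B {x} = rk-cl x A⊆B

  rk-++ : ∀ {B} A → A ⊆cl B → rk (A ++ B) ≤ rk B
  rk-++ [] A⊆clB = ≤-refl
  rk-++ {B} (x ∷ A) A⊆clB =
    ≤-trans (cl-mono (xs⊆ys++xs B A) (A⊆clB (here refl))) (rk-++ A (A⊆clB ∘ there))

  rk-⊆cl : ∀ {A B} → A ⊆cl B → rk A ≤ rk B
  rk-⊆cl {A} {B} A⊆clB = ≤-trans (rk-mono (xs⊆xs++ys A B)) (rk-++ A A⊆clB)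

  cl-trans : ∀ {A B} → A ⊆cl B → cl A ⊑ cl B
  cl-trans {A} {B} A⊆clB {x} x∈clA =
    ≤-trans (rk-mono (∷⁺ʳ x (xs⊆ys++xs B A)))
      (≤-trans (cl-mono (xs⊆xs++ys A B) x∈clA) (rk-++ A A⊆clB))

  rk≥⇒⊆cl : ∀ {A B} → A ⊆cl B → rk B ≤ rk A → B ⊆cl A
  rk≥⇒⊆cl {A} {B} A⊆clB B≤A b∈B =
    ≤-trans (rk-mono (∈-∷⁺ʳ (xs⊆ys++xs B A b∈B) (xs⊆xs++ys A B)))
      (≤-trans (rk-++ A A⊆clB) B≤A)

  rk-∷-∉cl : ∀ {A x} → ¬ cl A x → rk (x ∷ A) ≡ suc (rk A)
  rk-∷-∉cl {A} {x} x∉clA = ≤-antisym (rk-∷ x A) (≰⇒> x∉clA)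

  exchange : ∀ {A x y} → ¬ cl A y → cl (x ∷ A) y → cl (y ∷ A) x
  exchange {A} {x} {y} y∉clA y∈clxA = begin
    rk (x ∷ y ∷ A)  ≤⟨ rk-mono swap ⟩
    rk (y ∷ x ∷ A)  ≤⟨ y∈clxA ⟩
    rk (x ∷ A)      ≤⟨ rk-∷ x A ⟩
    suc (rk A)      ≤⟨ ≰⇒> y∉clA ⟩
    rk (y ∷ A)      ∎
    where
    open ≤-Reasoning
    swap : x ∷ y ∷ A ⊆ y ∷ x ∷ A
    swap (here p)          = there (here p)
    swap (there (here p))  = here p
    swap (there (there p)) = there (there p)

  -- If y were outside `cl A`, exchange would put x into `cl (y ∷ A)`, which is contained in `cl B`.
  cl-∩ : ∀ {A B x y} → A ⊆ B → ¬ cl B x → cl B y → cl (x ∷ A) y → cl A y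
  cl-∩ {A} {B} {x} {y} A⊆B x∉clB y∈clB y∈clxA with cl? A y
  ... | yes y∈clA = y∈clA
  ... | no  y∉clA = contradiction (cl-trans yA⊆clB (exchange y∉clA y∈clxA)) x∉clB
    where
    yA⊆clB : y ∷ A ⊆cl B
    yA⊆clB (here refl) = y∈clB
    yA⊆clB (there a∈A) = cl-∈ (A⊆B a∈A)

open RankFunction

-- The modular cut generated by two flats.  Lists stand for the flats they
-- span, and modular pairs enter only in the form (cl B , cl (x ∷ A)) with
-- A ⊆ B and x ∉ cl B, whose intersection is cl A.

data Cut {U R} (ρ : RankFunction U R) (S T : List U) : List U → Set where
  genˡ : Cut ρ S T S
  genʳ : Cut ρ S T T
  up   : ∀ {A B} → Cut ρ S T A → (∀ {a} → a ∈ A → cl ρ B a) → Cut ρ S T B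
  meet : ∀ {A B x} → A ⊆ B → Cut ρ S T B → Cut ρ S T (x ∷ A) → ¬ cl ρ B x →
         Cut ρ S T A

-- Single-element extension along the generated cut

module Extension (em : ExcludedMiddle 0ℓ) {U R} (ρ : RankFunction U R)
                 (e : U) (loop : cl ρ [] e) (S T : List U) where

  private
    C : List U → Set
    C = Cut ρ S T

  -- This is Crapo's extension: `e` is to lie in exactly the flats of the cut, so it adds one to the
  -- rank of a set outside the cut. Being a loop of `ρ`, `e` does not affect whether a list belongs
  -- to the cut.
  Raised : List U → Set
  Raised X = e ∈ X × ¬ C X

  rk⁺ : List U → ℕ
  rk⁺ X = if ⌊ em {P = Raised X} ⌋ then suc (rk ρ X) else rk ρ X

  rk⁺-raised : ∀ {X} → Raised X → rk⁺ X ≡ suc (rk ρ X)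
  rk⁺-raised {X} p with em {P = Raised X}
  ... | yes _ = refl
  ... | no ¬p = contradiction p ¬p

  rk⁺-unraised : ∀ {X} → ¬ Raised X → rk⁺ X ≡ rk ρ X
  rk⁺-unraised {X} ¬p with em {P = Raised X}
  ... | yes p = contradiction p ¬p
  ... | no  _ = refl

  rk⁺-fresh : ∀ {X} → e ∉ X → rk⁺ X ≡ rk ρ X
  rk⁺-fresh e∉X = rk⁺-unraised (e∉X ∘ proj₁)

  rk⁺-cut : ∀ {X} → C X → rk⁺ X ≡ rk ρ X
  rk⁺-cut c = rk⁺-unraised (λ p → proj₂ p c)

  rk≤rk⁺ : ∀ X → rk ρ X ≤ rk⁺ X
  rk≤rk⁺ X with em {P = Raised X}
  ... | yes _ = n≤1+n _
  ... | no  _ = ≤-refl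

  rk⁺≤suc : ∀ X → rk⁺ X ≤ suc (rk ρ X)
  rk⁺≤suc X with em {P = Raised X}
  ... | yes _ = ≤-refl
  ... | no  _ = n≤1+n _

  unraised⇒C : ∀ {X} → e ∈ X → ¬ Raised X → C X
  unraised⇒C e∈X ¬p = decidable-stable em (λ ¬c → ¬p (e∈X , ¬c))

  C-⊆ : ∀ {A B} → A ⊆ B → C A → C B
  C-⊆ A⊆B c = up c (cl-∈ ρ ∘ A⊆B)

  loop-cl : ∀ X → cl ρ X e
  loop-cl X = cl-mono ρ (λ ()) loop

  C-e∷ : ∀ {X} → C (e ∷ X) → C X
  C-e∷ {X} c = up c λ { (here refl) → loop-cl X ; (there x∈X) → cl-∈ ρ x∈X }

  rk⁺-mono : ∀ {A B} → A ⊆ B → rk⁺ A ≤ rk⁺ B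
  rk⁺-mono {A} {B} A⊆B with em {P = Raised A} | em {P = Raised B}
  ... | no _         | no _  = rk-mono ρ A⊆B
  ... | no _         | yes _ = m≤n⇒m≤1+n (rk-mono ρ A⊆B)
  ... | yes _        | yes _ = s≤s (rk-mono ρ A⊆B)
  -- Here B is in the cut. If its rank were at most that of A, both would span the same flat and A
  -- would be in the cut too.
  ... | yes (i , ¬c) | no ¬p = ≰⇒> λ B≤A →
    ¬c (up (unraised⇒C (A⊆B i) ¬p) (rk≥⇒⊆cl ρ (cl-∈ ρ ∘ A⊆B) B≤A))

  rk⁺-∷ : ∀ x A → rk⁺ (x ∷ A) ≤ suc (rk⁺ A)
  rk⁺-∷ x A with em {P = Raised (x ∷ A)}
  ... | no _                   = ≤-trans (rk-∷ ρ x A) (s≤s (rk≤rk⁺ A))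
  ... | yes (here refl , _)    = s≤s (≤-trans (loop-cl A) (rk≤rk⁺ A))
  ... | yes (there e∈A , ¬c)   = s≤s (≤-trans (rk-∷ ρ x A)
    (≤-reflexive (sym (rk⁺-raised (e∈A , ¬c ∘ C-⊆ (xs⊆x∷xs A x))))))

  -- Since x adds one to `rk ρ`, the balance is kept only if the unit contributed by `e` is present
  -- at A and vanishes at `x ∷ A`.
  rk⁺-stalls : ∀ {A x} → ¬ cl ρ A x → rk⁺ (x ∷ A) ≤ rk⁺ A → Raised A × C (x ∷ A)
  rk⁺-stalls {A} {x} x∉clA h = rA , unraised⇒C (there (proj₁ rA)) ¬rxA
    where
    rA : Raised A
    rA = decidable-stable em λ ¬r → x∉clA
      (≤-trans (rk≤rk⁺ (x ∷ A)) (≤-trans h (≤-reflexive (rk⁺-unraised ¬r))))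
    ¬rxA : ¬ Raised (x ∷ A)
    ¬rxA r = x∉clA (s≤s⁻¹ (≤-trans (≤-reflexive (sym (rk⁺-raised r)))
      (≤-trans h (rk⁺≤suc A))))

  rk⁺-cl : ∀ {A B} x → A ⊆ B → rk⁺ (x ∷ A) ≤ rk⁺ A → rk⁺ (x ∷ B) ≤ rk⁺ B
  rk⁺-cl {A} {B} x A⊆B h with cl? ρ B x
  ... | no x∉clB = begin
    rk⁺ (x ∷ B)     ≡⟨ rk⁺-cut (C-⊆ (∷⁺ʳ x A⊆B) cxA) ⟩
    rk ρ (x ∷ B)    ≤⟨ rk-∷ ρ x B ⟩
    suc (rk ρ B)    ≡⟨ rk⁺-raised (A⊆B (proj₁ rA) , ¬cB) ⟨
    rk⁺ B           ∎
    where
    open ≤-Reasoning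
    stall = rk⁺-stalls (x∉clB ∘ cl-mono ρ A⊆B) h
    rA    = proj₁ stall
    cxA   = proj₂ stall
    ¬cB : ¬ C B
    -- Closure under modular intersections enters here: with B and `x ∷ A` in the cut, A would be in
    -- it as well and could not be raised.
    ¬cB cB = proj₂ rA (meet A⊆B cB cxA x∉clB)
  ... | yes x∈clB with em {P = Raised (x ∷ B)}
  ...   | no _ = ≤-trans x∈clB (rk≤rk⁺ B)
  ...   | yes (i , ¬c) = ≤-trans (s≤s x∈clB) (≤-reflexive (sym (rk⁺-raised (e∈B , ¬cB))))
    where
    ¬cB : ¬ C B
    ¬cB = ¬c ∘ C-⊆ (xs⊆x∷xs B x)
    -- Otherwise `e` is x itself. Then `e ∷ A` is raised while A is not, against `h`.
    e∈B : e ∈ B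
    e∈B = decidable-stable em λ e∉B → absurd i e∉B
      where
      absurd : e ∈ x ∷ B → ¬ e ∉ B
      absurd (there e∈B) e∉B = e∉B e∈B
      absurd (here refl) e∉B = <-irrefl refl (begin-strict
        rk ρ A             ≤⟨ rk-mono ρ (xs⊆x∷xs A e) ⟩
        rk ρ (e ∷ A)       <⟨ ≤-refl ⟩
        suc (rk ρ (e ∷ A)) ≡⟨ rk⁺-raised (here refl , ¬c ∘ C-⊆ (∷⁺ʳ e A⊆B)) ⟨
        rk⁺ (e ∷ A)        ≤⟨ h ⟩
        rk⁺ A              ≡⟨ rk⁺-fresh (e∉B ∘ A⊆B) ⟩
        rk ρ A             ∎)
        where open ≤-Reasoning

  rk⁺-≤ : ∀ X → rk⁺ X ≤ R
  rk⁺-≤ X with em {P = Raised X}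
  ... | no _         = rk-≤ ρ X
  -- A list of rank at least R spans everything, in particular S, so it is in the cut and is never
  -- raised.
  ... | yes (_ , ¬c) = ≰⇒> λ R≤X → ¬c (up genˡ λ {s} _ → ≤-trans (rk-≤ ρ (s ∷ X)) R≤X)

  extension : RankFunction U R
  extension = record
    { rk      = rk⁺
    ; rk-[]   = trans (rk⁺-fresh λ ()) (rk-[] ρ)
    ; rk-mono = rk⁺-mono
    ; rk-∷    = rk⁺-∷
    ; rk-cl   = rk⁺-cl
    ; rk-≤    = rk⁺-≤
    }

  cut⇒cl⁺ : ∀ {X} → e ∉ X → C X → cl extension X e
  cut⇒cl⁺ {X} e∉X c = begin
    rk⁺ (e ∷ X)    ≡⟨ rk⁺-cut (C-⊆ (xs⊆x∷xs X e) c) ⟩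
    rk ρ (e ∷ X)   ≤⟨ loop-cl X ⟩
    rk ρ X         ≡⟨ rk⁺-fresh e∉X ⟨
    rk⁺ X          ∎
    where open ≤-Reasoning

  -- If X were outside the cut, so would be `e ∷ X`, which would then be raised. The derivation
  -- obtained here is what `cut-transfer` replays in the limit.
  cl⁺⇒cut : ∀ {X} → e ∉ X → cl extension X e → C X
  cl⁺⇒cut {X} e∉X h = C-e∷ (unraised⇒C (here refl) λ r → <-irrefl refl (begin-strict
    rk ρ X             ≤⟨ rk-mono ρ (xs⊆x∷xs X e) ⟩
    rk ρ (e ∷ X)       <⟨ ≤-refl ⟩
    suc (rk ρ (e ∷ X)) ≡⟨ rk⁺-raised r ⟨
    rk⁺ (e ∷ X)        ≤⟨ h ⟩
    rk⁺ X              ≡⟨ rk⁺-fresh e∉X ⟩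
    rk ρ X             ∎))
    where open ≤-Reasoning

-- Ranks of arbitrary sets

module MatroidRank (em : ExcludedMiddle 0ℓ) {E : Set} (M : Matroid E) where
  open Matroid M

  -- Excluded middle decides whether a longer independent list in F exists; `d` bounds the number of
  -- improvements still possible.
  hasRank-∃ : ∀ F → ∃ (HasRank M F)
  hasRank-∃ F = grow rank [] indep-[] [] (≤-reflexive (sym (+-identityʳ rank)))
    where
    grow : ∀ d xs → Indep xs → All F xs → rank ≤ d + length xs → ∃ (HasRank M F)
    grow d xs ixs Fxs bound
      with em {P = ∃[ ys ] (Indep ys × All F ys × length xs < length ys)}
    ... | no none = length xs , (xs , ixs , Fxs , refl) ,
      λ ys iys Fys → ≮⇒≥ λ l → none (ys , iys , Fys , l)
    grow zero xs ixs Fxs bound | yes (ys , iys , _ , l) =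
      contradiction (≤-trans l (≤-trans (rank-bound iys) bound)) (<-irrefl refl)
    grow (suc d) xs ixs Fxs bound | yes (ys , iys , Fys , l) = grow d ys iys Fys
      (≤-trans bound (≤-trans (≤-reflexive (sym (+-suc d (length xs)))) (+-monoʳ-≤ d l)))

  hasRank-mono : ∀ {F G a b} → F ⊑ G → HasRank M F a → HasRank M G b → a ≤ b
  hasRank-mono F⊑G ((xs , ixs , Fxs , refl) , _) (_ , maxG) =
    maxG xs ixs (All.map F⊑G Fxs)

  hasRank-bound : ∀ {F k} → HasRank M F k → k ≤ rank
  hasRank-bound ((xs , ixs , _ , refl) , _) = rank-bound ixs

  extend-basis : ∀ {F k} → HasRank M F k → ∀ xs → Indep xs → All F xs →
                 ∃[ ys ] (Indep ys × All F ys × xs ⊆ ys × length ys ≡ k)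
  extend-basis {F} {k} ((bs , ibs , Fbs , refl) , maxF) xs₀ ixs₀ Fxs₀ =
    grow (length bs) xs₀ ixs₀ Fxs₀ (m≤m+n _ _)
    where
    grow : ∀ d xs → Indep xs → All F xs → length bs ≤ d + length xs →
           ∃[ ys ] (Indep ys × All F ys × xs ⊆ ys × length ys ≡ length bs)
    grow d xs ixs Fxs bound with length xs <? length bs
    ... | no ≮ = xs , ixs , Fxs , id , ≤-antisym (maxF xs ixs Fxs) (≮⇒≥ ≮)
    grow zero xs ixs Fxs bound | yes l = contradiction (≤-trans l bound) (<-irrefl refl)
    grow (suc d) xs ixs Fxs bound | yes l with indep-aug ixs ibs l
    ... | y , y∈bs , _ , iyxs
      with grow d (y ∷ xs) iyxs (All.lookup Fbs y∈bs ∷ Fxs)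
             (≤-trans bound (≤-reflexive (sym (+-suc d (length xs)))))
    ...   | ys , iys , Fys , yxs⊆ys , eq = ys , iys , Fys , yxs⊆ys ∘ there , eq

  -- If ys were longer than xs by two, xs could be augmented twice from ys. At most one of the two
  -- new elements is x, and the other one, lying in F, contradicts the maximality of xs.
  hasRank-∪ : ∀ {F G x a b} → G ⊑ F ∪ ｛ x ｝ → HasRank M F a → HasRank M G b → b ≤ suc a
  hasRank-∪ {F} {G} {x} {a} G⊑ ((xs , ixs , Fxs , refl) , maxF) ((ys , iys , Gys , refl) , _)
    = ≮⇒≥ λ l → absurd l (indep-aug ixs iys (<-trans (n<1+n _) l))
    where
    absurd : suc (length xs) < length ys → ∃[ y ] (y ∈ ys × y ∉ xs × Indep (y ∷ xs)) → ⊥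
    absurd l (y , y∈ys , _ , iyxs) with G⊑ (All.lookup Gys y∈ys)
    ... | inj₁ Fy   = <-irrefl refl (maxF (y ∷ xs) iyxs (Fy ∷ Fxs))
    ... | inj₂ refl with indep-aug iyxs iys l
    ...   | z , z∈ys , z∉yxs , izyxs with G⊑ (All.lookup Gys z∈ys)
    ...     | inj₂ refl = z∉yxs (here refl)
    ...     | inj₁ Fz   = <-irrefl refl (maxF (z ∷ xs) izxs (Fz ∷ Fxs))
      where
      skip : z ∷ xs ⊆ z ∷ x ∷ xs
      skip (here p)  = here p
      skip (there p) = there (there p)
      izxs : Indep (z ∷ xs)
      izxs with indep⇒uniq izyxs
      ... | (_ ∷ z≢xs) ∷ _ ∷ uxs = indep-sub izyxs (z≢xs ∷ uxs) skip

  -- `A′` and `B′` play the roles of A and B with x added. Extend a basis xs of A to a basis of B.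
  -- An element of `B′` augmenting the latter can only be x, and then `x ∷ xs` is too long for `A′`.
  hasRank-cl : ∀ {A A′ B B′ x a a′ b b′} → A ⊑ B → (∀ {y} → y ≡ x → A′ y) → A ⊑ A′ →
               B′ ⊑ B ∪ ｛ x ｝ → HasRank M A a → HasRank M A′ a′ → a′ ≤ a →
               HasRank M B b → HasRank M B′ b′ → b′ ≤ b
  hasRank-cl {x = x} A⊑B x∈A′ A⊑A′ B′⊑ ((xs , ixs , Axs , refl) , _) (_ , maxA′) a′≤a
    hB@(_ , maxB) ((zs , izs , B′zs , refl) , _)
    with extend-basis hB xs ixs (All.map A⊑B Axs)
  ... | ys , iys , Bys , xs⊆ys , refl = ≮⇒≥ λ l → absurd (indep-aug iys izs l)
    where
    absurd : ¬ (∃[ z ] (z ∈ zs × z ∉ ys × Indep (z ∷ ys)))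
    absurd (z , z∈zs , z∉ys , izys) with B′⊑ (All.lookup B′zs z∈zs)
    ... | inj₁ Bz   = <-irrefl refl (maxB (z ∷ ys) izys (Bz ∷ Bys))
    ... | inj₂ refl = <-irrefl refl (≤-trans (maxA′ (z ∷ xs) izxs
                        (x∈A′ refl ∷ All.map A⊑A′ Axs)) a′≤a)
      where
      izxs : Indep (z ∷ xs)
      izxs = indep-sub izys
        (All.tabulate (λ i → λ { refl → z∉ys (xs⊆ys i) }) ∷ indep⇒uniq ixs) (∷⁺ʳ z xs⊆ys)

-- The matroid of a rank function

module RankMatroid (em : ExcludedMiddle 0ℓ) {U R} (ρ : RankFunction U R) where

  private
    _≟U_ : (x y : U) → Dec (x ≡ y)
    x ≟U y = em

  -- Quantifying over all sublists makes heredity immediate.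
  Independent : List U → Set
  Independent ys = Unique ys ×
    (∀ {z zs} → z ∈ ys → zs ⊆ ys → z ∉ zs → ¬ cl ρ zs z)

  independent-[] : Independent []
  independent-[] = [] , λ ()

  independent-⊆ : ∀ {xs ys} → Independent ys → Unique xs → xs ⊆ ys → Independent xs
  independent-⊆ (_ , free) uxs xs⊆ys =
    uxs , λ z∈xs zs⊆xs → free (xs⊆ys z∈xs) (xs⊆ys ∘ zs⊆xs)

  independent-∷ : ∀ {x xs} → Independent xs → ¬ cl ρ xs x → Independent (x ∷ xs)
  independent-∷ {x} {xs} (uxs , free) x∉cl =
    All.tabulate (λ i → λ { refl → x∉cl (cl-∈ ρ i) }) ∷ uxs , free′
    where
    free′ : ∀ {z zs} → z ∈ x ∷ xs → zs ⊆ x ∷ xs → z ∉ zs → ¬ cl ρ zs z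
    free′ {zs = zs} (here refl) zs⊆ z∉zs z∈cl = x∉cl (cl-mono ρ zs⊆xs z∈cl)
      where
      zs⊆xs : zs ⊆ xs
      zs⊆xs i with zs⊆ i
      ... | here refl = contradiction i z∉zs
      ... | there j   = j
    -- Remove x from zs. The rest does not span z, because xs is independent, so exchange puts x
    -- into the closure of z and the rest, hence into `cl xs`.
    free′ {z} {zs} (there z∈xs) zs⊆ z∉zs z∈cl =
      x∉cl (cl-mono ρ (∈-∷⁺ʳ z∈xs zs′⊆xs)
        (exchange ρ (free z∈xs zs′⊆xs (z∉zs ∘ proj₁ ∘ ∈-filter⁻ ≢x? {xs = zs}))
          (cl-mono ρ zs⊆x∷zs′ z∈cl)))
      where
      ≢x? : ∀ y → Dec (¬ y ≡ x)
      ≢x? y = ¬? (y ≟U x)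
      zs′ = filter ≢x? zs
      zs′⊆xs : zs′ ⊆ xs
      zs′⊆xs i with ∈-filter⁻ ≢x? {xs = zs} i
      ... | i∈zs , y≢x with zs⊆ i∈zs
      ...   | here y≡x = contradiction y≡x y≢x
      ...   | there j  = j
      zs⊆x∷zs′ : zs ⊆ x ∷ zs′
      zs⊆x∷zs′ {y} i with y ≟U x
      ... | yes y≡x = here y≡x
      ... | no  y≢x = there (∈-filter⁺ ≢x? i y≢x)

  independent-tail : ∀ {x xs} → Independent (x ∷ xs) → Independent xs
  independent-tail ind@(_ ∷ uxs , _) = independent-⊆ ind uxs there

  independent-head : ∀ {x xs} → Independent (x ∷ xs) → ¬ cl ρ xs x
  independent-head (x≢xs ∷ _ , free) =
    free (here refl) there (λ x∈xs → All.lookup x≢xs x∈xs refl)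

  rk-independent : ∀ {xs} → Independent xs → rk ρ xs ≡ length xs
  rk-independent {[]}     _   = rk-[] ρ
  rk-independent {x ∷ xs} ind = trans (rk-∷-∉cl ρ (independent-head ind))
    (cong suc (rk-independent (independent-tail ind)))

  independent-aug : ∀ {xs ys} → Independent xs → Independent ys → length xs < length ys →
                    ∃[ y ] (y ∈ ys × y ∉ xs × Independent (y ∷ xs))
  independent-aug {xs} {ys} ixs iys l with all? (cl? ρ xs) ys
  ... | yes spanned = contradiction l (≤⇒≯ (begin
    length ys  ≡⟨ rk-independent iys ⟨
    rk ρ ys    ≤⟨ rk-⊆cl ρ (All.lookup spanned) ⟩
    rk ρ xs    ≡⟨ rk-independent ixs ⟩
    length xs  ∎))
    where open ≤-Reasoning
  ... | no ¬spanned with find (¬All⇒Any¬ (cl? ρ xs) ys ¬spanned)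
  ...   | y , y∈ys , y∉cl = y , y∈ys , y∉cl ∘ cl-∈ ρ , independent-∷ ixs y∉cl

  basis : ∀ B → ∃[ I ] (Independent I × I ⊆ B × _⊆cl_ ρ B I)
  basis [] = [] , independent-[] , id , λ ()
  basis (x ∷ B) with basis B
  ... | I , ind , I⊆B , B⊆clI with cl? ρ I x
  ...   | yes x∈cl = I , ind , there ∘ I⊆B ,
          λ { (here refl) → x∈cl ; (there b∈B) → B⊆clI b∈B }
  ...   | no  x∉cl = x ∷ I , independent-∷ ind x∉cl , ∷⁺ʳ x I⊆B ,
          λ { (here refl) → cl-∈ ρ (here refl)
            ; (there b∈B) → cl-mono ρ (xs⊆x∷xs I x) (B⊆clI b∈B) }

  -- The field `rk-≤` bounds the rank only from above; `full` ensures that the value R is attained.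
  module _ (full : ∃[ bs ] (Independent bs × length bs ≡ R)) where

    matroid : Matroid U
    matroid = record
      { Indep      = Independent
      ; indep⇒uniq = proj₁
      ; indep-[]   = independent-[]
      ; indep-sub  = λ iys uxs xs⊆ys → independent-⊆ iys uxs xs⊆ys
      ; indep-aug  = independent-aug
      ; rank       = R
      ; rank-basis = full
      ; rank-bound = λ {xs} ixs → ≤-trans (≤-reflexive (sym (rk-independent ixs))) (rk-≤ ρ xs)
      }

    open MatroidRank em matroid

    hasRank-cl-list : ∀ {F B} → All F B → F ⊑ cl ρ B → HasRank matroid F (rk ρ B)
    hasRank-cl-list {F} {B} FB F⊑clB with basis B
    ... | I , ind , I⊆B , B⊆clI =
      (I , ind , All.tabulate (All.lookup FB ∘ I⊆B) ,
        trans (sym (rk-independent ind))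
          (≤-antisym (rk-mono ρ I⊆B) (rk-⊆cl ρ B⊆clI))) ,
      λ ys iys Fys → ≤-trans (≤-reflexive (sym (rk-independent iys)))
        (rk-⊆cl ρ (F⊑clB ∘ All.lookup Fys))

    rk≤hasRank : ∀ {F k B} → HasRank matroid F k → All F B → rk ρ B ≤ k
    rk≤hasRank {B = B} (_ , maxF) FB with basis B
    ... | I , ind , I⊆B , B⊆clI = ≤-trans (rk-⊆cl ρ B⊆clI)
      (≤-trans (≤-reflexive (rk-independent ind))
        (maxF I ind (All.tabulate (All.lookup FB ∘ I⊆B))))

    spanning : ∀ F → ∃[ B ] (All F B × F ⊑ cl ρ B)
    spanning F with hasRank-∃ F
    ... | _ , (xs , ixs , Fxs , refl) , maxF = xs , Fxs , λ {x} Fx →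
      decidable-stable (cl? ρ xs x) λ x∉cl →
        <-irrefl refl (maxF (x ∷ xs) (independent-∷ ixs x∉cl) (Fx ∷ Fxs))

    cl-flat : ∀ B → Flat matroid (cl ρ B)
    cl-flat B x k ((xs , ixs , clxs , refl) , _) h = begin
      rk ρ (x ∷ B)  ≤⟨ rk≤hasRank h (inj₂ refl ∷ All.tabulate (inj₁ ∘ cl-∈ ρ)) ⟩
      length xs     ≡⟨ rk-independent ixs ⟨
      rk ρ xs       ≤⟨ rk-⊆cl ρ (All.lookup clxs) ⟩
      rk ρ B        ∎
      where open ≤-Reasoning

    -- A finite list spanning G also spans G with x added, so the two have the same rank.
    flat-cl : ∀ {G X} → Flat matroid G → All G X → cl ρ X ⊑ G
    flat-cl {G} {X} flatG GX {x} x∈clX with spanning G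
    ... | B , GB , G⊑clB = flatG x (rk ρ B) (hasRank-cl-list GB G⊑clB)
      (hasRank-cl-list (All.map inj₁ GB)
        λ { (inj₁ Gy) → G⊑clB Gy
          ; (inj₂ refl) → cl-trans ρ (G⊑clB ∘ All.lookup GX) x∈clX })

    -- This turns a `meet` step into an instance of `modint`. The union has the rank of `x ∷ B`, and
    -- by `cl-∩` the intersection has the rank of A.
    cl-modular : ∀ {A B x} → A ⊆ B → ¬ cl ρ B x →
                 ModularPair matroid (cl ρ B) (cl ρ (x ∷ A))
    cl-modular {A} {B} {x} A⊆B x∉clB =
      rk ρ B , rk ρ (x ∷ A) , rk ρ (x ∷ B) , rk ρ A ,
      hasRank-cl-list (All.tabulate (cl-∈ ρ)) id ,
      hasRank-cl-list (All.tabulate (cl-∈ ρ)) id ,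
      hasRank-cl-list
        (inj₂ (cl-∈ ρ (here refl)) ∷ All.tabulate (inj₁ ∘ cl-∈ ρ))
        (λ { (inj₁ p) → cl-mono ρ (xs⊆x∷xs B x) p
           ; (inj₂ p) → cl-mono ρ (∷⁺ʳ x A⊆B) p }) ,
      hasRank-cl-list
        (All.tabulate λ i → cl-∈ ρ (A⊆B i) , cl-∈ ρ (there i))
        (λ (p , q) → cl-∩ ρ A⊆B x∉clB p q) ,
      (begin
        rk ρ B + rk ρ (x ∷ A)    ≡⟨ cong (rk ρ B +_) (rk-∷-∉cl ρ (x∉clB ∘ cl-mono ρ A⊆B)) ⟩
        rk ρ B + suc (rk ρ A)    ≡⟨ +-suc (rk ρ B) (rk ρ A) ⟩
        suc (rk ρ B) + rk ρ A    ≡⟨ cong (_+ rk ρ A) (rk-∷-∉cl ρ x∉clB) ⟨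
        rk ρ (x ∷ B) + rk ρ A    ∎)
      where open ≡-Reasoning

    -- Descend to a member `cl B` of least rank. Intersecting it with a member inside G gives a
    -- member `cl I` within `cl B` of no smaller rank, so `cl I` equals `cl B` and G contains
    -- `cl B`.
    ∩-closed⇒OTE :
      (∀ {𝓜} → IsModularCut matroid 𝓜 → ∀ {B D I} → 𝓜 (cl ρ B) → 𝓜 (cl ρ D) →
        All (cl ρ B ∩ cl ρ D) I → cl ρ B ∩ cl ρ D ⊑ cl ρ I → 𝓜 (cl ρ I)) →
      OTE matroid
    ∩-closed⇒OTE ∩-closed 𝓜 cut (F₀ , 𝓜F₀) = principal (rk ρ (proj₁ start)) (proj₁ start)
      (proj₂ start) ≤-refl
      where
      open IsModularCut cut
      generators : ∀ {F} → 𝓜 F → ∃[ B ] (All F B × 𝓜 (cl ρ B))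
      generators {F} 𝓜F with spanning F
      ... | B , FB , F⊑clB = B , FB , upward F (cl ρ B) 𝓜F (cl-flat B) F⊑clB
      start : ∃[ B ] 𝓜 (cl ρ B)
      start = proj₁ (generators 𝓜F₀) , proj₂ (proj₂ (generators 𝓜F₀))
      principal : ∀ d B → 𝓜 (cl ρ B) → rk ρ B ≤ d → Principal matroid 𝓜
      principal d B 𝓜B bound with em {P = ∃[ D ] (𝓜 (cl ρ D) × rk ρ D < rk ρ B)}
      principal zero B 𝓜B bound | yes (D , _ , D<B) = contradiction (≤-trans D<B bound) λ ()
      principal (suc d) B 𝓜B bound | yes (D , 𝓜D , D<B) =
        principal d D 𝓜D (s≤s⁻¹ (≤-trans D<B bound))
      ... | no minimal = cl ρ B , cl-flat B , λ G flatG →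
        mk⇔ (below G flatG) (λ clB⊑G → upward (cl ρ B) G 𝓜B flatG clB⊑G)
        where
        below : ∀ G → Flat matroid G → 𝓜 G → cl ρ B ⊑ G
        below G flatG 𝓜G with generators 𝓜G
        ... | D , GD , 𝓜D with spanning (cl ρ B ∩ cl ρ D)
        ...   | I , I⊑ , ⊑clI = λ y∈clB → flat-cl flatG GD
                (cl-trans ρ (proj₂ ∘ All.lookup I⊑)
                  (cl-trans ρ (rk≥⇒⊆cl ρ (proj₁ ∘ All.lookup I⊑) B≤I) y∈clB))
          where
          B≤I : rk ρ B ≤ rk ρ I
          B≤I = ≮⇒≥ λ I<B → minimal (I , ∩-closed cut 𝓜B 𝓜D I⊑ ⊑clI , I<B)

-- Enumerations

unpair : ℕ → ℕ × ℕ
unpair zero    = 0 , 0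
unpair (suc n) = next (unpair n)
  where
  next : ℕ × ℕ → ℕ × ℕ
  next (zero  , y) = suc y , 0
  next (suc x , y) = x , suc y

-- `unpair` walks along antidiagonals. Each recursive call goes one step back: `(x , suc y)` comes
-- after `(suc x , y)`, and `(suc x , 0)` after the end `(0 , x)` of the previous antidiagonal.
unpair-surjective : ∀ x y → ∃[ n ] unpair n ≡ (x , y)
unpair-surjective x y = diagonal (x + y) x y refl
  where
  diagonal : ∀ s x y → x + y ≡ s → ∃[ n ] unpair n ≡ (x , y)
  diagonal s zero zero _ = 0 , refl
  diagonal (suc s) (suc x) zero eq
    with n , p ← diagonal s zero x (trans (sym (+-identityʳ x)) (suc-injective eq))
    = suc n , advance {n} p
    where
    advance : ∀ {n} → unpair n ≡ (zero , x) → unpair (suc n) ≡ (suc x , zero)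
    advance p rewrite p = refl
  diagonal s x (suc y) eq
    with n , p ← diagonal s (suc x) y (trans (sym (+-suc x y)) eq)
    = suc n , advance {n} p
    where
    advance : ∀ {n} → unpair n ≡ (suc x , y) → unpair (suc n) ≡ (x , suc y)
    advance p rewrite p = refl

unpair-≤ : ∀ n → proj₁ (unpair n) + proj₂ (unpair n) ≤ n
unpair-≤ zero = z≤n
unpair-≤ (suc n) with unpair n | unpair-≤ n
... | zero  , y | h = s≤s (≤-trans (≤-reflexive (+-identityʳ y)) h)
... | suc x , y | h = ≤-trans (≤-reflexive (+-suc x y)) (m≤n⇒m≤1+n h)

Enumeration : Set → Set
Enumeration A = Σ (ℕ → A) λ h → ∀ a → ∃[ n ] h n ≡ a

×-enumeration : ∀ {A B} → Enumeration A → Enumeration B → Enumeration (A × B)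
×-enumeration {A} {B} (f , f-onto) (g , g-onto) = h , onto
  where
  h : ℕ → A × B
  h n = f (proj₁ (unpair n)) , g (proj₂ (unpair n))
  onto : ∀ p → ∃[ n ] h n ≡ p
  onto (a , b) with f-onto a | g-onto b
  ... | i , refl | j , refl with unpair-surjective i j
  ...   | n , eq = n , cong (λ p → f (proj₁ p) , g (proj₂ p)) eq

List-enumeration : ∀ {A} → Enumeration A → Enumeration (List A)
List-enumeration {A} (f , f-onto) = h , onto
  where
  ofLength : ℕ → ℕ → List A
  ofLength zero    _ = []
  ofLength (suc k) n = f (proj₁ (unpair n)) ∷ ofLength k (proj₂ (unpair n))
  h : ℕ → List A
  h n = ofLength (proj₁ (unpair n)) (proj₂ (unpair n))
  ofLength-onto : ∀ xs → ∃[ n ] ofLength (length xs) n ≡ xs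
  ofLength-onto [] = 0 , refl
  ofLength-onto (x ∷ xs) with f-onto x | ofLength-onto xs
  ... | i , refl | j , eq with unpair-surjective i j
  ...   | n , p = n , trans (cong (λ q → f (proj₁ q) ∷ ofLength (length xs) (proj₂ q)) p)
                            (cong (f i ∷_) eq)
  onto : ∀ xs → ∃[ n ] h n ≡ xs
  onto xs with ofLength-onto xs
  ... | j , eq with unpair-surjective (length xs) j
  ...   | n , p = n , trans (cong (λ q → ofLength (proj₁ q) (proj₂ q)) p) eq

⊎ℕ-enumeration : ExcludedMiddle 0ℓ → ∀ {E} → Countable E → Enumeration (E ⊎ ℕ)
⊎ℕ-enumeration em {E} (f , f-inj) = (λ n → pick (unpair n)) , onto
  where
  pick : ℕ × ℕ → E ⊎ ℕ
  pick (zero  , k) = inj₂ k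
  pick (suc _ , k) with em {P = ∃[ x ] f x ≡ k}
  ... | yes (x , _) = inj₁ x
  -- Numbers outside the image of `f` need some value. A new point always serves, even when E is
  -- empty.
  ... | no  _       = inj₂ k
  pick-inj₁ : ∀ x → pick (1 , f x) ≡ inj₁ x
  pick-inj₁ x with em {P = ∃[ y ] f y ≡ f x}
  ... | yes (y , eq) = cong inj₁ (f-inj eq)
  ... | no  none     = contradiction (x , refl) none
  onto : ∀ u → ∃[ n ] pick (unpair n) ≡ u
  onto (inj₁ x) with unpair-surjective 1 (f x)
  ... | n , eq = n , trans (cong pick eq) (pick-inj₁ x)
  onto (inj₂ k) with unpair-surjective 0 k
  ... | n , eq = n , cong pick eq

-- Only the second coordinate of `unpair n` is read. Letting the first one be m forces `m ≤ n`, by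
-- `unpair-≤`.
recurring : ∀ {A} → Enumeration A → Σ (ℕ → A) λ h → ∀ m a → ∃[ n ] (m ≤ n × h n ≡ a)
recurring (f , f-onto) = f ∘ proj₂ ∘ unpair , onto
  where
  onto : ∀ m a → ∃[ n ] (m ≤ n × f (proj₂ (unpair n)) ≡ a)
  onto m a with f-onto a
  ... | j , eq with unpair-surjective m j
  ...   | n , p = n ,
    ≤-trans (≤-reflexive (sym (cong proj₁ p))) (≤-trans (m≤m+n _ _) (unpair-≤ n)) ,
    trans (cong (f ∘ proj₂) p) eq

-- The tower of extensions and its limit

module Tower (em : ExcludedMiddle 0ℓ) {E : Set} (M : Matroid E) (count : Countable E) where
  open Matroid M
  open MatroidRank em M

  U : Set
  U = E ⊎ ℕ

  -- Ignoring the new points makes all of them loops at stage 0.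
  old : List U → Pred E 0ℓ
  old X x = inj₁ x ∈ X

  rk₀ : List U → ℕ
  rk₀ X = proj₁ (hasRank-∃ (old X))

  rk₀-hasRank : ∀ X → HasRank M (old X) (rk₀ X)
  rk₀-hasRank X = proj₂ (hasRank-∃ (old X))

  old-∷ : ∀ x X → old (inj₁ x ∷ X) ⊑ old X ∪ ｛ x ｝
  old-∷ x X (here refl) = inj₂ refl
  old-∷ x X (there i)   = inj₁ i

  rk₀-inj₂ : ∀ k X → rk₀ (inj₂ k ∷ X) ≤ rk₀ X
  rk₀-inj₂ k X = hasRank-mono (λ { (there i) → i }) (rk₀-hasRank (inj₂ k ∷ X)) (rk₀-hasRank X)

  ground : RankFunction U rank
  ground = record
    { rk      = rk₀
    ; rk-[]   = n≤0⇒n≡0 (none (rk₀-hasRank []))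
    ; rk-mono = λ {A} {B} A⊆B → hasRank-mono (λ i → A⊆B i) (rk₀-hasRank A) (rk₀-hasRank B)
    ; rk-∷    = rk₀-∷
    ; rk-cl   = rk₀-cl
    ; rk-≤    = λ A → hasRank-bound (rk₀-hasRank A)
    }
    where
    none : ∀ {k} → HasRank M (old []) k → k ≤ 0
    none (([] , _ , _ , refl) , _) = z≤n
    none ((_ ∷ _ , _ , () ∷ _ , _) , _)
    rk₀-∷ : ∀ u A → rk₀ (u ∷ A) ≤ suc (rk₀ A)
    rk₀-∷ (inj₁ x) A = hasRank-∪ (old-∷ x A) (rk₀-hasRank A) (rk₀-hasRank (inj₁ x ∷ A))
    rk₀-∷ (inj₂ k) A = m≤n⇒m≤1+n (rk₀-inj₂ k A)
    rk₀-cl : ∀ {A B} u → A ⊆ B → rk₀ (u ∷ A) ≤ rk₀ A → rk₀ (u ∷ B) ≤ rk₀ B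
    rk₀-cl {A} {B} (inj₂ k) _   _ = rk₀-inj₂ k B
    rk₀-cl {A} {B} (inj₁ x) A⊆B h =
      hasRank-cl (λ i → A⊆B i) (λ { refl → here refl }) there (old-∷ x B)
        (rk₀-hasRank A) (rk₀-hasRank (inj₁ x ∷ A)) h
        (rk₀-hasRank B) (rk₀-hasRank (inj₁ x ∷ B))

  private
    schedule = recurring (×-enumeration lists lists)
      where lists = List-enumeration (⊎ℕ-enumeration em count)

  task : ℕ → List U × List U
  task = proj₁ schedule

  task-recurs : ∀ m t → ∃[ n ] (m ≤ n × task n ≡ t)
  task-recurs = proj₂ schedule

  -- The loop invariant is built together with the stages, because extending stage n requires
  -- `inj₂ n` to be a loop there.
  stage⁺ : ∀ n → Σ (RankFunction U rank) λ ρ → ∀ m → n ≤ m → cl ρ [] (inj₂ m)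
  stage⁺ zero    = ground , λ m _ → rk₀-inj₂ m []
  stage⁺ (suc n) = X.extension , still-loop
    where
    ρ = proj₁ (stage⁺ n)
    module X = Extension em ρ (inj₂ n) (proj₂ (stage⁺ n) n ≤-refl)
                 (proj₁ (task n)) (proj₂ (task n))
    still-loop : ∀ m → suc n ≤ m → cl X.extension [] (inj₂ m)
    still-loop m n<m = begin
      X.rk⁺ (inj₂ m ∷ [])   ≡⟨ X.rk⁺-fresh (λ { (here refl) → <-irrefl refl n<m }) ⟩
      rk ρ (inj₂ m ∷ [])    ≤⟨ proj₂ (stage⁺ n) m (<⇒≤ n<m) ⟩
      rk ρ []               ≤⟨ X.rk≤rk⁺ [] ⟩
      X.rk⁺ []              ∎
      where open ≤-Reasoning

  stage : ℕ → RankFunction U rank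
  stage n = proj₁ (stage⁺ n)

  stage-loop : ∀ n m → n ≤ m → cl (stage n) [] (inj₂ m)
  stage-loop n = proj₂ (stage⁺ n)

  module Step (n : ℕ) = Extension em (stage n) (inj₂ n) (stage-loop n n ≤-refl)
                          (proj₁ (task n)) (proj₂ (task n))

  -- Stabilisation of ranks and the limit

  birth : U → ℕ
  birth (inj₁ _) = 0
  -- The point `inj₂ k` is placed in the step from stage k to stage `suc k`; at stage k it is still
  -- a loop.
  birth (inj₂ k) = suc k

  Born : ℕ → List U → Set
  Born n X = ∀ {x} → x ∈ X → birth x ≤ n

  births : List U → ℕ
  births []      = 0
  births (x ∷ X) = birth x ⊔ births X

  born-births : ∀ X → Born (births X) X
  born-births (x ∷ X) (here refl) = m≤m⊔n (birth x) (births X)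
  born-births (x ∷ X) (there i)   = ≤-trans (born-births X i) (m≤n⊔m (birth x) (births X))

  born-≤ : ∀ {m n X} → m ≤ n → Born m X → Born n X
  born-≤ m≤n b i = ≤-trans (b i) m≤n

  born-∷ : ∀ {n x X} → birth x ≤ n → Born n X → Born n (x ∷ X)
  born-∷ bx bX (here refl) = bx
  born-∷ bx bX (there i)   = bX i

  born⇒∉ : ∀ {n X} → Born n X → inj₂ n ∉ X
  born⇒∉ b i = <-irrefl refl (b i)

  -- Later steps move only points that are not in X, so `rk⁺-fresh` applies to each of them.
  stage-+ : ∀ {n X} k → Born n X → rk (stage (k + n)) X ≡ rk (stage n) X
  stage-+         zero    b = refl
  stage-+ {n} {X} (suc k) b =
    trans (Step.rk⁺-fresh (k + n) (born⇒∉ (born-≤ (m≤n+m n k) b))) (stage-+ k b)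

  rk∞ : List U → ℕ
  rk∞ X = rk (stage (births X)) X

  births-≤ : ∀ {n} X → Born n X → births X ≤ n
  births-≤ []      b = z≤n
  births-≤ (x ∷ X) b = ⊔-lub (b (here refl)) (births-≤ X (b ∘ there))

  rk∞-stage : ∀ {n X} → Born n X → rk∞ X ≡ rk (stage n) X
  rk∞-stage {n} {X} b = sym (trans
    (cong (λ m → rk (stage m) X) (sym (m∸n+n≡m (births-≤ X b))))
    (stage-+ (n ∸ births X) (born-births X)))

  -- Each axiom involves finitely many elements and is inherited from a stage at which all of them
  -- are born.
  limit : RankFunction U rank
  limit = record
    { rk      = rk∞
    ; rk-[]   = rk-[] ground
    ; rk-mono = λ {A} {B} A⊆B → let b = born-births B in
        subst₂ _≤_ (sym (rk∞-stage (b ∘ A⊆B))) (sym (rk∞-stage b))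
          (rk-mono (stage (births B)) A⊆B)
    ; rk-∷    = λ x A → let b = born-births (x ∷ A) in
        subst₂ _≤_ (sym (rk∞-stage b)) (cong suc (sym (rk∞-stage (b ∘ there))))
          (rk-∷ (stage (births (x ∷ A))) x A)
    ; rk-cl   = λ {A} {B} x A⊆B h → let b = born-births (x ∷ B) in
        subst₂ _≤_ (sym (rk∞-stage b)) (sym (rk∞-stage (b ∘ there)))
          (rk-cl (stage (births (x ∷ B))) x A⊆B
            (subst₂ _≤_ (rk∞-stage (b ∘ ∷⁺ʳ x A⊆B)) (rk∞-stage (b ∘ there ∘ A⊆B)) h))
    ; rk-≤    = λ A → rk-≤ (stage (births A)) A
    }

  cl-stage⇒limit : ∀ {n x X} → birth x ≤ n → Born n X → cl (stage n) X x → cl limit X x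
  cl-stage⇒limit bx bX = subst₂ _≤_ (sym (rk∞-stage (born-∷ bx bX))) (sym (rk∞-stage bX))

  cl-limit⇒stage : ∀ {n x X} → birth x ≤ n → Born n X → cl limit X x → cl (stage n) X x
  cl-limit⇒stage bx bX = subst₂ _≤_ (rk∞-stage (born-∷ bx bX)) (rk∞-stage bX)

  restrict : ℕ → List U → List U
  restrict n = filter (λ x → birth x ≤? n)

  restrict-∈ : ∀ {n X x} → x ∈ restrict n X → x ∈ X × birth x ≤ n
  restrict-∈ {n} {X} = ∈-filter⁻ (λ x → birth x ≤? n) {xs = X}

  restrict-born : ∀ n X → Born n (restrict n X)
  restrict-born n X = proj₂ ∘ restrict-∈ {n} {X}

  loop-or-born : ∀ n x → cl (stage n) [] x ⊎ birth x ≤ n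
  loop-or-born n (inj₁ _) = inj₂ z≤n
  loop-or-born n (inj₂ k) with suc k ≤? n
  ... | yes k<n = inj₂ k<n
  ... | no  k≮n = inj₁ (stage-loop n k (≮⇒≥ k≮n))

  restrict-spans : ∀ n X → _⊆cl_ (stage n) X (restrict n X)
  restrict-spans n X {x} x∈X with loop-or-born n x
  ... | inj₁ loop = cl-mono (stage n) (λ ()) loop
  ... | inj₂ bx   = cl-∈ (stage n) (∈-filter⁺ (λ x → birth x ≤? n) x∈X bx)

  -- Restriction of the limit to E

  open RankMatroid em limit

  rk∞-map : ∀ xs → rk∞ (map inj₁ xs) ≡ rk₀ (map inj₁ xs)
  rk∞-map xs = rk∞-stage born
    where
    born : Born 0 (map inj₁ xs)
    born i with ∈-map⁻ inj₁ i
    ... | _ , _ , refl = z≤n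

  old-map : ∀ {xs x} → old (map inj₁ xs) x → x ∈ xs
  old-map i with ∈-map⁻ inj₁ i
  ... | _ , j , refl = j

  rk₀-indep : ∀ {xs} → Indep xs → rk₀ (map inj₁ xs) ≡ length xs
  rk₀-indep {xs} ixs with rk₀ (map inj₁ xs) | rk₀-hasRank (map inj₁ xs)
  ... | _ | (ys , iys , Xys , refl) , max =
    ≤-antisym (≮⇒≥ λ l → let (y , y∈ys , y∉xs , _) = indep-aug ixs iys l in
                y∉xs (old-map (All.lookup Xys y∈ys)))
              (max xs ixs (All.tabulate (∈-map⁺ inj₁)))

  indep⇒independent : ∀ xs → Indep xs → Independent (map inj₁ xs)
  indep⇒independent [] _ = independent-[]
  indep⇒independent (x ∷ xs) ixxs with indep⇒uniq ixxs
  ... | _ ∷ uxs = independent-∷ (indep⇒independent xs ixs) (<⇒≱ (begin-strict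
    rk∞ (map inj₁ xs)        ≡⟨ trans (rk∞-map xs) (rk₀-indep ixs) ⟩
    length xs                <⟨ ≤-refl ⟩
    length (x ∷ xs)          ≡⟨ trans (rk∞-map (x ∷ xs)) (rk₀-indep ixxs) ⟨
    rk∞ (map inj₁ (x ∷ xs))  ∎))
    where
    open ≤-Reasoning
    ixs = indep-sub ixxs uxs there

  -- The rank of `x ∷ xs` exceeds the length of xs, so xs can be augmented from within `x ∷ xs`, and
  -- the new element must be x.
  independent⇒indep : ∀ xs → Independent (map inj₁ xs) → Indep xs
  independent⇒indep [] _ = indep-[]
  independent⇒indep (x ∷ xs) ind = add (rk₀-hasRank (map inj₁ (x ∷ xs)))
    where
    ixs : Indep xs
    ixs = independent⇒indep xs (independent-tail ind)
    larger : length xs < rk₀ (map inj₁ (x ∷ xs))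
    larger = subst₂ _<_ (trans (rk∞-map xs) (rk₀-indep ixs)) (rk∞-map (x ∷ xs))
      (≰⇒> (independent-head ind))
    add : HasRank M (old (map inj₁ (x ∷ xs))) (rk₀ (map inj₁ (x ∷ xs))) → Indep (x ∷ xs)
    add ((ys , iys , Xys , eq) , _) with indep-aug ixs iys (subst (length xs <_) (sym eq) larger)
    ... | y , y∈ys , y∉xs , iyxs with old-map (All.lookup Xys y∈ys)
    ...   | here refl  = iyxs
    ...   | there y∈xs = contradiction y∈xs y∉xs

  full : ∃[ bs ] (Independent bs × length bs ≡ rank)
  full with rank-basis
  ... | bs , ibs , eq = map inj₁ bs , indep⇒independent bs ibs , trans (length-map inj₁ bs) eq

  N : Matroid U
  N = matroid full

  -- Modular cuts of the limit

  -- A list X at stage n stands for its part born by then, because elements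
  -- that are still loops will move later.
  flat-stage : ∀ {n G X} → Flat N G → (∀ {x} → x ∈ X → birth x ≤ n → G x) →
               ∀ {a} → birth a ≤ n → cl (stage n) X a → G a
  flat-stage {n} {G} {X} flatG GX ba a∈cl =
    flat-cl full flatG (All.tabulate λ i → GX (proj₁ (restrict-∈ {X = X} i)) (restrict-born n X i))
      (cl-stage⇒limit ba (restrict-born n X) (cl-trans (stage n) (restrict-spans n X) a∈cl))

  -- Induction on the derivation, each rule being matched by a closure property of `𝓜`. Stating it
  -- for every flat G containing the born part of X lets `up` keep the same G.
  cut-transfer : ∀ {𝓜} → IsModularCut N 𝓜 → ∀ {n} →
    𝓜 (cl limit (proj₁ (task n))) → 𝓜 (cl limit (proj₂ (task n))) →
    Born n (proj₁ (task n)) → Born n (proj₂ (task n)) →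
    ∀ {X} → Cut (stage n) (proj₁ (task n)) (proj₂ (task n)) X →
    ∀ {G} → Flat N G → (∀ {x} → x ∈ X → birth x ≤ n → G x) → 𝓜 G
  cut-transfer {𝓜} cut {n} 𝓜S 𝓜T bS bT = transfer
    where
    open IsModularCut cut
    transfer : ∀ {X} → Cut (stage n) (proj₁ (task n)) (proj₂ (task n)) X →
               ∀ {G} → Flat N G → (∀ {x} → x ∈ X → birth x ≤ n → G x) → 𝓜 G
    transfer genˡ flatG GX =
      upward _ _ 𝓜S flatG (flat-cl full flatG (All.tabulate λ i → GX i (bS i)))
    transfer genʳ flatG GX =
      upward _ _ 𝓜T flatG (flat-cl full flatG (All.tabulate λ i → GX i (bT i)))
    transfer (up c A⊆clB) flatG GX =
      transfer c flatG λ a∈A ba → flat-stage flatG GX ba (A⊆clB a∈A)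
    transfer (meet {A} {B} {x} A⊆B cB cxA x∉clB) {G} flatG GX =
      upward _ G (modint _ _ 𝓜B 𝓜xA (cl-modular full A′⊆B′ x∉clB′)) flatG
        λ {y} (p , q) → flat-cl full flatG
          (All.tabulate λ i → GX (proj₁ (restrict-∈ {X = A} i)) (restrict-born n A i))
          (cl-∩ limit {x = x} {y} A′⊆B′ x∉clB′ p q)
      where
      A′ = restrict n A
      B′ = restrict n B
      A′⊆B′ : A′ ⊆ B′
      A′⊆B′ i with restrict-∈ {X = A} i
      ... | a∈A , ba = ∈-filter⁺ (λ x → birth x ≤? n) (A⊆B a∈A) ba
      bx : birth x ≤ n
      -- An unborn x would be a loop of the stage and so lie in `cl B`.
      bx with loop-or-born n x
      ... | inj₁ loop = contradiction (cl-mono (stage n) (λ ()) loop) x∉clB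
      ... | inj₂ b    = b
      x∉clB′ : ¬ cl limit B′ x
      x∉clB′ x∈ = x∉clB (cl-mono (stage n) (proj₁ ∘ restrict-∈ {X = B})
        (cl-limit⇒stage bx (restrict-born n B) x∈))
      𝓜B : 𝓜 (cl limit B′)
      𝓜B = transfer cB (cl-flat full B′)
        λ i b → cl-∈ limit (∈-filter⁺ (λ x → birth x ≤? n) i b)
      𝓜xA : 𝓜 (cl limit (x ∷ A′))
      𝓜xA = transfer cxA (cl-flat full (x ∷ A′))
        λ { {y} (here refl) _ → cl-∈ limit {a = y} (here refl)
          ; (there i)   b → cl-∈ limit (there (∈-filter⁺ (λ x → birth x ≤? n) i b)) }

  N-OTE : OTE N
  N-OTE = ∩-closed⇒OTE full ∩-closed
    where
    ∩-closed : ∀ {𝓜} → IsModularCut N 𝓜 → ∀ {B D I} → 𝓜 (cl limit B) → 𝓜 (cl limit D) →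
      All (cl limit B ∩ cl limit D) I → cl limit B ∩ cl limit D ⊑ cl limit I → 𝓜 (cl limit I)
    ∩-closed cut {B} {D} {I} 𝓜B 𝓜D _ ⊑clI
      -- Waiting for I as well keeps `inj₂ n` out of I, as `cl⁺⇒cut` requires.
      with task-recurs (births (B ++ D ++ I)) (B , D)
    ... | n , late , refl = cut-transfer cut 𝓜B 𝓜D bB bD
            (Step.cl⁺⇒cut n (born⇒∉ bI) p∈clI) (cl-flat full I) (λ i _ → cl-∈ limit i)
      where
      b : Born n (B ++ D ++ I)
      b = born-≤ late (born-births (B ++ D ++ I))
      bB : Born n B
      bB = b ∘ xs⊆xs++ys B (D ++ I)
      bD : Born n D
      bD = b ∘ xs⊆ys++xs (D ++ I) B ∘ xs⊆xs++ys D I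
      bI : Born n I
      bI = b ∘ xs⊆ys++xs (D ++ I) B ∘ xs⊆ys++xs I D
      p∈clB : cl limit B (inj₂ n)
      p∈clB = cl-stage⇒limit ≤-refl (born-≤ (n≤1+n n) bB) (Step.cut⇒cl⁺ n (born⇒∉ bB) genˡ)
      p∈clD : cl limit D (inj₂ n)
      p∈clD = cl-stage⇒limit ≤-refl (born-≤ (n≤1+n n) bD) (Step.cut⇒cl⁺ n (born⇒∉ bD) genʳ)
      p∈clI : cl (stage (suc n)) I (inj₂ n)
      p∈clI = cl-limit⇒stage ≤-refl (born-≤ (n≤1+n n) bI) (⊑clI {inj₂ n} (p∈clB , p∈clD))

theorem12 : ExcludedMiddle 0ℓ →
    ∀ {E : Set} (M : Matroid E) → Countable E →
    ∃[ E′ ] Σ (Matroid E′) λ N → ∃[ ι ]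
    (Injective {A = E} {B = E′} _≡_ _≡_ ι × OTE N ×
    Matroid.rank N ≡ Matroid.rank M ×
    (∀ xs → Matroid.Indep M xs ⇔ Matroid.Indep N (map ι xs)))
theorem12 em M count =
  U , N , inj₁ , inj₁-injective , N-OTE , refl ,
  λ xs → mk⇔ (indep⇒independent xs) (independent⇒indep xs)
  where open Tower em M count
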